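{- For all integers $r,k\in\mathbb{Z}$ and every integer $n\ge 0$, $$s_{n+1}^{(r,k)}(x)=x\,s_{n}^{(r,k)}(x)-\frac{r}{n+1}\sum_{l=0}^{n}\binom{n+1}{l}(-1)^{n+1-l}B_{n+1-l}\,s_{l}^{(r,k)}(x)-\frac{1}{n+1}\left\{s_{n+1}^{(r+1,k)}(x)-s_{n+1}^{(r+1,k-1)}(x)\right\}$$ as polynomials in $x$.
   Context: For $k\in\mathbb{Z}$, $Li_k(x)=\sum_{n=1}^{\infty}\frac{x^n}{n^k}$ is the polylogarithm, regarded as a formal power series; $\frac{Li_k(1-e^{ -t})}{1-e^{ -t}}$ is then a formal power series in $t$ over $\mathbb{C}$. The ordinary Bernoulli numbers $B_n$ are defined by $\frac{t}{e^t-1}=\sum_{n\ge0}B_n\frac{t^n}{n!}$ (so $B_1=-\tfrac12$). For $r,k\in\mathbb{Z}$, the higher-order Bernoulli and poly-Bernoulli mixed type polynomials $s_n^{(r,k)}(x)$ are defined by $\left(\frac{t}{e^t-1}\right)^r\frac{Li_k(1-e^{ -t})}{1-e^{ -t}}e^{xt}=\sum_{n\ge0}s_n^{(r,k)}(x)\frac{t^n}{n!}$. -}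

module Defs where

open import Algebra.Bundles using (RawRing; CommutativeRing)
import Algebra.Definitions.RawSemiring as RawSemiringDefinitions
open import Data.Fin.Base using (Fin; toℕ)
open import Data.Integer.Base using (ℤ; +_; -[1+_])
open import Data.List.Base using (List; []; _∷_; map)
open import Data.Nat.Base as ℕ using (ℕ; zero; suc; NonZero; _!; _∸_)
open import Data.Nat.Properties using (_!≢0)
open import Level using (_⊔_) renaming (suc to lsuc)

-- A commutative ring in which every positive integer is invertible,
-- for instance ℂ, or any other field of characteristic 0.

record ℚAlgebra c ℓ : Set (lsuc (c ⊔ ℓ)) where
  field
    commutativeRing : CommutativeRing c ℓ
  open CommutativeRing commutativeRing public
  open RawSemiringDefinitions (RawRing.rawSemiring rawRing) public
    using (_×_; _^_; sum)
  field
    1/_        : (n : ℕ) .{{_ : NonZero n}} → Carrier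
    1/-inverse : (n : ℕ) .{{_ : NonZero n}} → (n × 1#) * (1/ n) ≈ 1#

module PowerSeries {c ℓ} (A : RawRing c ℓ) where

  private
    module A where
      open RawRing A public
      open RawSemiringDefinitions rawSemiring public using (_^_; sum)

  -- The coefficient of tⁿ is the value at n.

  Series : Set c
  Series = ℕ → A.Carrier

  const : A.Carrier → Series
  const a zero    = a
  const a (suc _) = A.0#

  rawRing : RawRing c ℓ
  rawRing = record
    { Carrier = Series
    ; _≈_     = λ f g → ∀ n → f n A.≈ g n
    ; _+_     = λ f g n → f n A.+ g n
    ; _*_     = λ f g n → A.sum λ (i : Fin (suc n)) →
                  f (toℕ i) A.* g (n ∸ toℕ i)
    ; -_      = λ f n → A.- f n
    ; 0#      = const A.0#
    ; 1#      = const A.1#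
    }

  open RawRing rawRing public hiding (Carrier)
  open RawSemiringDefinitions rawSemiring public using (_^_)

  infixl 6 _-_
  _-_ : Series → Series → Series
  f - g = f + (- g)

  t : Series
  t zero          = A.0#
  t (suc zero)    = A.1#
  t (suc (suc _)) = A.0#

  -- f (g (t)) = Σₘ fₘ g(t)ᵐ, for g without constant term; then gᵐ does not
  -- contribute to the coefficient of tⁿ when m > n.

  infixr 9 _∘_
  _∘_ : Series → Series → Series
  (f ∘ g) n = A.sum λ (m : Fin (suc n)) → f (toℕ m) A.* (g ^ toℕ m) n

  -- For f with constant term 1, the geometric series Σₘ (1 - f)ᵐ.

  reciprocal : Series → Series
  reciprocal f = (λ _ → A.1#) ∘ (1# - f)

  -- Integer powers, for f with constant term 1.

  infixr 8 _^ℤ_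
  _^ℤ_ : Series → ℤ → Series
  f ^ℤ (+ m)    = f ^ m
  f ^ℤ -[1+ m ] = reciprocal f ^ suc m

  -- f / g for f without constant term and g = t + O(t²): cancel the common
  -- factor t first.

  infixl 7 _/_
  _/_ : Series → Series → Series
  f / g = (λ n → f (suc n)) * reciprocal (λ n → g (suc n))

  -- e^{at}, given the inverse factorials in A.

  exp : (ℕ → A.Carrier) → A.Carrier → Series
  exp 1/! a n = (a A.^ n) A.* 1/! n

module Polynomials {c ℓ} (A : RawRing c ℓ) where

  private module A = RawRing A

  -- Coefficients by increasing degree; trailing zeros are allowed, and
  -- equality compares coefficients.

  Poly : Set c
  Poly = List A.Carrier

  coeff : Poly → ℕ → A.Carrier
  coeff []      _       = A.0#
  coeff (a ∷ p) zero    = a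
  coeff (a ∷ p) (suc i) = coeff p i

  const : A.Carrier → Poly
  const a = a ∷ []

  x : Poly
  x = A.0# ∷ A.1# ∷ []

  infixr 8 _·_
  _·_ : A.Carrier → Poly → Poly
  a · p = map (a A.*_) p

  private
    add : Poly → Poly → Poly
    add []      q       = q
    add (a ∷ p) []      = a ∷ p
    add (a ∷ p) (b ∷ q) = (a A.+ b) ∷ add p q

    mul : Poly → Poly → Poly
    mul []      q = []
    mul (a ∷ p) q = add (a · q) (A.0# ∷ mul p q)

  rawRing : RawRing c ℓ
  rawRing = record
    { Carrier = Poly
    ; _≈_     = λ p q → ∀ i → coeff p i A.≈ coeff q i
    ; _+_     = add
    ; _*_     = mul
    ; -_      = map A.-_
    ; 0#      = []
    ; 1#      = const A.1#
    }

  open RawRing rawRing public hiding (Carrier)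
  open RawSemiringDefinitions rawSemiring public using (_×_; sum)

  infixl 6 _-_
  _-_ : Poly → Poly → Poly
  p - q = p + (- q)

module MixedType {c ℓ} (K : ℚAlgebra c ℓ) where

  private module K = ℚAlgebra K
  open K using (Carrier; 1/_)

  module K[x] = Polynomials K.rawRing
  module K[[t]] = PowerSeries K.rawRing
  module K[x][[t]] = PowerSeries K[x].rawRing

  open K[x] using (Poly)

  fromℤ : ℤ → Carrier
  fromℤ (+ m)    = m K.× K.1#
  fromℤ -[1+ m ] = K.- (suc m K.× K.1#)

  1/! : ℕ → Carrier
  1/! n = 1/_ (n !) {{n !≢0}}

  e^[_t] : Carrier → K[[t]].Series
  e^[_t] = K[[t]].exp 1/!

  e^xt : K[x][[t]].Series
  e^xt = K[x][[t]].exp (λ n → K[x].const (1/! n)) K[x].x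

  Li : ℤ → K[[t]].Series
  Li k         zero    = K.0#
  Li (+ m)     (suc n) = (1/ suc n) K.^ m
  Li -[1+ m ]  (suc n) = (suc n K.× K.1#) K.^ suc m

  t/[e^t-1] : K[[t]].Series
  t/[e^t-1] = t / (e^[ K.1# t] - 1#)
    where open K[[t]]

  Li[1-e^-t]/[1-e^-t] : ℤ → K[[t]].Series
  Li[1-e^-t]/[1-e^-t] k = (Li k ∘ u) / u
    where
    open K[[t]]
    u : Series
    u = 1# - e^[ K.- K.1# t]

  B : ℕ → Carrier
  B n = (n !) K.× t/[e^t-1] n

  embed : K[[t]].Series → K[x][[t]].Series
  embed f n = K[x].const (f n)

  generating : ℤ → ℤ → K[x][[t]].Series
  generating r k =
    embed (t/[e^t-1] K[[t]].^ℤ r) * embed (Li[1-e^-t]/[1-e^-t] k) * e^xt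
    where open K[x][[t]]

  s : ℤ → ℤ → ℕ → Poly
  s r k n = (n !) K[x].× generating r k n

-- With θ = t d/dt, T = t/(eᵗ - 1) and Lₖ = Liₖ(1 - e⁻ᵗ)/(1 - e⁻ᵗ), one has
--   θ T = (1 - T(-t)) T,   θ Lₖ = T (Lₖ₋₁ - Lₖ),   θ eˣᵗ = x t eˣᵗ.
-- Hence the generating function G of s⁽ʳ'ᵏ⁾ satisfies
--   θ G = r (1 - T(-t)) G + Tʳ⁺¹ (Lₖ₋₁ - Lₖ) eˣᵗ + x t G,
-- and the recurrence is n! times the coefficient of tⁿ⁺¹ in this equation.

module Submission where

open import Defs
open import Algebra.Bundles using (CommutativeRing)
open import Algebra.Morphism.Structures using (IsRingHomomorphism; IsRingMonomorphism)
import Algebra.Morphism.RingMonomorphism as RingMonomorphism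
open import Algebra.Structures using (IsCommutativeRing)
import Algebra.Properties.Ring as RingProperties
import Algebra.Properties.CommutativeMonoid.Mult as CommutativeMonoidMult
import Algebra.Properties.Semiring.Exp as SemiringExp
import Algebra.Properties.Semiring.Mult as SemiringMult
import Algebra.Properties.Semiring.Sum as SemiringSum
import Algebra.Solver.Ring.NaturalCoefficients.Default as SemiringSolver
open import Data.Fin.Base using (Fin; toℕ; zero; suc)
open import Data.Fin.Properties using (toℕ≤pred[n])
open import Data.Integer.Base as ℤ using (ℤ; 1ℤ; +_; -[1+_])
open import Data.List.Base using ([]; _∷_)
open import Data.Nat.Base as ℕ using (ℕ; zero; suc; _∸_; _!; _<_; s≤s)
open import Data.Nat.Combinatorics using (_C_; nCk≡n!/k![n-k]!; k![n∸k]!∣n!)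
open import Data.Nat.DivMod using (m/n*n≡m)
open import Data.Nat.Properties as ℕ using (_!≢0; _!*_!≢0; m+[n∸m]≡n; ≤-trans; n<1+n)
open import Data.Product.Base using (_,_)
open import Relation.Binary.PropositionalEquality.Core as ≡ using (_≡_)
import Relation.Binary.Reasoning.Setoid as ≈-Reasoning

-- The factor T in θ Lₖ comes from θ(1 - e⁻ᵗ) = t e⁻ᵗ = (1 - e⁻ᵗ) T; the chain rule and θ Liₖ =
-- Liₖ₋₁ supply the rest. As u = 1 - e⁻ᵗ has no inverse among the power series, the chain rule takes
-- the form θ(f ∘ u) u = (θ f ∘ u) θ u, and u is cancelled only at the end. The signs of the
-- Bernoulli numbers arise because the logarithmic derivative of T is found as 1 - eᵗ T, and eᵗ T is
-- T(-t). Composition is defined with a truncation that moves with the degree, so its recursive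
-- properties rest on a single Horner rule. Whatever is free of x is proved over the scalars and
-- transported coefficientwise; polynomials enter only with eˣᵗ.

nCk*[k!*[n∸k]!]≡n! : ∀ {n k} → k ℕ.≤ n → (n C k) ℕ.* (k ! ℕ.* (n ∸ k) !) ≡ n !
nCk*[k!*[n∸k]!]≡n! {n} {k} k≤n = ≡.trans
  (≡.cong (ℕ._* (k ! ℕ.* (n ∸ k) !)) (nCk≡n!/k![n-k]! k≤n))
  (m/n*n≡m (k![n∸k]!∣n! k≤n))
  where instance _ = k !* (n ∸ k) !≢0

-- Elementary identities in a commutative ring.

module RingLemmas {c ℓ} (R : CommutativeRing c ℓ) where

  open CommutativeRing R
  open RingProperties ring
  open SemiringMult semiring
  open ≈-Reasoning setoid

  ×≈×1* : ∀ n x → n × x ≈ (n × 1#) * x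
  ×≈×1* n x = begin
    n × x         ≈⟨ ×-congʳ n (*-identityˡ x) ⟨
    n × (1# * x)  ≈⟨ ×-assoc-* n 1# x ⟨
    (n × 1#) * x  ∎

  y+[x-y]≈x : ∀ x y → y + (x - y) ≈ x
  y+[x-y]≈x x y = begin
    y + (x - y)    ≈⟨ +-congˡ (+-comm x (- y)) ⟩
    y + (- y + x)  ≈⟨ +-assoc y (- y) x ⟨
    y - y + x      ≈⟨ +-congʳ (-‿inverseʳ y) ⟩
    0# + x         ≈⟨ +-identityˡ x ⟩
    x              ∎

-- The commutative ring of formal power series.

module SeriesOver {c ℓ} (R : CommutativeRing c ℓ) where

  private
    module R where
      open CommutativeRing R public
      open RingProperties ring public
      open RingLemmas R public
      open SemiringMult semiring public
      open CommutativeMonoidMult +-commutativeMonoid public using (×-distrib-+)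
      open SemiringExp semiring public
      open SemiringSum semiring public
      open SemiringSolver commutativeSemiring public
        using (solve; _:+_; _:*_; _:=_; con)

  open PowerSeries R.rawRing

  tail : Series → Series
  tail f n = f (suc n)

  summand : Series → Series → (n : ℕ) → Fin (suc n) → R.Carrier
  summand f g n i = f (toℕ i) R.* g (n ∸ toℕ i)

  const-0# : ∀ n → const R.0# n R.≈ R.0#
  const-0# zero    = R.refl
  const-0# (suc n) = R.refl

  *-cong : ∀ {f f′ g g′} → f ≈ f′ → g ≈ g′ → f * g ≈ f′ * g′
  *-cong f≈f′ g≈g′ n = R.sum-cong-≋ {suc n} λ i →
    R.*-cong (f≈f′ (toℕ i)) (g≈g′ (n ∸ toℕ i))

  -- By definition the Cauchy product splits off its first summand. This is the mirror image,
  -- splitting off the last one; together they prove commutativity by induction on the degree.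
  *-suc : ∀ f g n → (f * g) (suc n) R.≈ (f * tail g) n R.+ f (suc n) R.* g 0
  *-suc f g zero = R.trans
    (R.+-congˡ (R.+-identityʳ _))
    (R.+-congʳ (R.sym (R.+-identityʳ _)))
  *-suc f g (suc n) = R.trans
    (R.+-congˡ (*-suc (tail f) g n))
    (R.sym (R.+-assoc _ _ _))

  *-comm : ∀ f g → f * g ≈ g * f
  *-comm f g zero    = R.+-congʳ (R.*-comm (f 0) (g 0))
  *-comm f g (suc n) = R.trans (*-suc f g n) (R.trans (R.+-comm _ _)
    (R.+-cong (R.*-comm (f (suc n)) (g 0)) (*-comm f (tail g) n)))

  *-distribʳ-+ : ∀ f g h → (g + h) * f ≈ g * f + h * f
  *-distribʳ-+ f g h n = R.trans
    (R.sum-cong-≋ {suc n} λ i → R.distribʳ (f (n ∸ toℕ i)) (g (toℕ i)) (h (toℕ i)))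
    (R.∑-distrib-+ (summand g f n) (summand h f n))

  scale-* : ∀ a f g n → ((λ m → a R.* f m) * g) n R.≈ a R.* (f * g) n
  scale-* a f g n = R.trans
    (R.sum-cong-≋ {suc n} λ i → R.*-assoc a (f (toℕ i)) (g (n ∸ toℕ i)))
    (R.sym (R.*-distribˡ-sum a (summand f g n)))

  -- Induction on the degree: `tail (f * g)` unfolds to `f 0` times `tail g` plus `tail f * g`,
  -- which avoids any reindexing of double sums.
  *-assoc : ∀ f g h → (f * g) * h ≈ f * (g * h)
  *-assoc f g h zero = R.solve 3
    (λ a b c → (a R.:* b R.:+ R.con 0) R.:* c R.:+ R.con 0
             R.:= a R.:* (b R.:* c R.:+ R.con 0) R.:+ R.con 0)
    R.refl (f 0) (g 0) (h 0)
  *-assoc f g h (suc n) = R.trans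
    (R.+-congˡ (R.trans (*-distribʳ-+ h (λ m → f 0 R.* g (suc m)) (tail f * g) n)
                        (R.+-cong (scale-* (f 0) (tail g) h n) (*-assoc (tail f) g h n))))
    (R.solve 5
      (λ a b c d e → (a R.:* b R.:+ R.con 0) R.:* c R.:+ (a R.:* d R.:+ e)
                   R.:= a R.:* (b R.:* c R.:+ d) R.:+ e)
      R.refl (f 0) (g 0) (h (suc n)) ((tail g * h) n) ((tail f * (g * h)) n))

  const-* : ∀ a f n → (const a * f) n R.≈ a R.* f n
  const-* a f zero    = R.+-identityʳ _
  const-* a f (suc n) = R.trans
    (R.+-congˡ (R.trans (R.sum-cong-≋ {suc n} λ i → R.zeroˡ (f (n ∸ toℕ i)))
                        (R.sum-replicate-zero (suc n))))
    (R.+-identityʳ _)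

  *-identityˡ : ∀ f → 1# * f ≈ f
  *-identityˡ f n = R.trans (const-* R.1# f n) (R.*-identityˡ (f n))

  isCommutativeRing : IsCommutativeRing _≈_ _+_ _*_ (-_) 0# 1#
  isCommutativeRing = record
    { isRing = record
      { +-isAbelianGroup = record
        { isGroup = record
          { isMonoid = record
            { isSemigroup = record
              { isMagma = record
                { isEquivalence = record
                  { refl  = λ _ → R.refl
                  ; sym   = λ p n → R.sym (p n)
                  ; trans = λ p q n → R.trans (p n) (q n)
                  }
                ; ∙-cong = λ p q n → R.+-cong (p n) (q n)
                }
              ; assoc = λ f g h n → R.+-assoc (f n) (g n) (h n)
              }
            ; identity =
                (λ f n → R.trans (R.+-congʳ (const-0# n)) (R.+-identityˡ (f n)))
              , (λ f n → R.trans (R.+-congˡ (const-0# n)) (R.+-identityʳ (f n)))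
            }
          ; inverse =
              (λ f n → R.trans (R.-‿inverseˡ (f n)) (R.sym (const-0# n)))
            , (λ f n → R.trans (R.-‿inverseʳ (f n)) (R.sym (const-0# n)))
          ; ⁻¹-cong = λ p n → R.-‿cong (p n)
          }
        ; comm = λ f g n → R.+-comm (f n) (g n)
        }
      ; *-cong     = λ {f} {f′} {g} {g′} → *-cong {f} {f′} {g} {g′}
      ; *-assoc    = *-assoc
      ; *-identity = *-identityˡ
                   , λ f n → R.trans (*-comm f 1# n) (*-identityˡ f n)
      ; distrib    = (λ f g h n → R.trans (*-comm f (g + h) n)
                         (R.trans (*-distribʳ-+ f g h n)
                           (R.+-cong (*-comm g f n) (*-comm h f n))))
                   , *-distribʳ-+
      }
    ; *-comm = *-comm
    }

  commutativeRing : CommutativeRing c ℓ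
  commutativeRing = record { isCommutativeRing = isCommutativeRing }

  private
    module S where
      open CommutativeRing commutativeRing public
      open RingProperties ring public
      open SemiringMult semiring public using (_×_)
      open SemiringSolver commutativeSemiring public
        using (solve; _:+_; _:*_; _:=_; con)

  ×-coefficient : ∀ m f n → (m S.× f) n R.≈ m R.× f n
  ×-coefficient zero    f n = const-0# n
  ×-coefficient (suc m) f n = R.+-congˡ (×-coefficient m f n)

  t*-suc : ∀ f n → (t * f) (suc n) R.≈ f n
  t*-suc f n = begin
    R.0# R.* f (suc n) R.+ (tail t * f) n  ≈⟨ R.+-cong (R.zeroˡ _)
                                                   (*-cong {g = f} tail-t (λ _ → R.refl) n) ⟩
    R.0# R.+ (1# * f) n                    ≈⟨ R.+-identityˡ _ ⟩
    (1# * f) n                             ≈⟨ *-identityˡ f n ⟩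
    f n                                    ∎
    where
    open ≈-Reasoning R.setoid
    tail-t : tail t ≈ 1#
    tail-t zero    = R.refl
    tail-t (suc n) = R.refl

  t*tail : ∀ f → f 0 R.≈ R.0# → t * tail f ≈ f
  t*tail f f₀≈0 zero    = R.trans (R.+-identityʳ _) (R.trans (R.zeroˡ _) (R.sym f₀≈0))
  t*tail f f₀≈0 (suc n) = t*-suc (tail f) n

  t*-cancel : ∀ f g → t * f ≈ t * g → f ≈ g
  t*-cancel f g eq n = R.trans (R.sym (t*-suc f n)) (R.trans (eq (suc n)) (t*-suc g n))

  -- The only summand that sees degree n of the second factor carries `u 0`. Inductions on the
  -- degree for compositions with u rest on this.
  *-cong-below : ∀ u {f g} n → u 0 R.≈ R.0# → (∀ i → i < n → f i R.≈ g i) →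
                 (u * f) n R.≈ (u * g) n
  *-cong-below u {f} {g} zero u₀≈0 eq = R.+-congʳ
    (R.trans (R.*-congʳ u₀≈0) (R.trans (R.zeroˡ _)
      (R.sym (R.trans (R.*-congʳ u₀≈0) (R.zeroˡ _)))))
  *-cong-below u {f} {g} (suc n) u₀≈0 eq = R.+-cong
    (R.trans (R.*-congʳ u₀≈0) (R.trans (R.zeroˡ _)
      (R.sym (R.trans (R.*-congʳ u₀≈0) (R.zeroˡ _)))))
    (R.sum-cong-≋ {suc n} λ i →
      R.*-congˡ {u (suc (toℕ i))} (eq (n ∸ toℕ i) (s≤s (ℕ.m∸n≤m n (toℕ i)))))

  -- The Euler derivation and the reflection t ↦ -t.

  -- The operator t d/dt: unlike d/dt itself, it preserves degrees.

  θ : Series → Series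
  θ f n = n R.× f n

  θ-cong : ∀ {f g} → f ≈ g → θ f ≈ θ g
  θ-cong eq n = R.×-congʳ n (eq n)

  θ-+ : ∀ f g → θ (f + g) ≈ θ f + θ g
  θ-+ f g n = R.×-distrib-+ (f n) (g n) n

  ×-zeroʳ : ∀ n → n R.× R.0# R.≈ R.0#
  ×-zeroʳ n = R.trans (R.×≈×1* n R.0#) (R.zeroʳ _)

  θ-const : ∀ a → θ (const a) ≈ 0#
  θ-const a zero    = R.refl
  θ-const a (suc n) = ×-zeroʳ (suc n)

  θ-t : θ t ≈ t
  θ-t zero          = R.refl
  θ-t (suc zero)    = R.+-identityʳ _
  θ-t (suc (suc n)) = ×-zeroʳ (suc (suc n))

  ×-sum : ∀ m {n} (v : Fin n → R.Carrier) → m R.× R.sum v R.≈ R.sum (λ i → m R.× v i)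
  ×-sum m {zero}  v = ×-zeroʳ m
  ×-sum m {suc n} v = R.trans (R.×-distrib-+ _ _ m) (R.+-congˡ (×-sum m (λ i → v (suc i))))

  -- In each summand of the Cauchy product the weight n splits as i + j, one part for each factor.
  θ-* : ∀ f g → θ (f * g) ≈ θ f * g + f * θ g
  θ-* f g n = R.trans (×-sum n (summand f g n)) (R.trans
    (R.sum-cong-≋ {suc n} λ i → leibniz (toℕ i) (n ∸ toℕ i) (m+[n∸m]≡n (toℕ≤pred[n] i)))
    (R.∑-distrib-+ (summand (θ f) g n) (summand f (θ g) n)))
    where
    leibniz : ∀ i j → i ℕ.+ j ≡ n →
              n R.× (f i R.* g j) R.≈ (i R.× f i) R.* g j R.+ f i R.* (j R.× g j)
    leibniz i j ≡.refl = R.trans (R.×-homo-+ _ i j)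
      (R.sym (R.+-cong (R.×-assoc-* i (f i) (g j)) (R.×-comm-* j (f i) (g j))))

  -- f(t) ↦ f(-t)

  σ : Series → Series
  σ f n = (R.- R.1#) R.^ n R.* f n

  σ-* : ∀ f g → σ (f * g) ≈ σ f * σ g
  σ-* f g n = R.trans (R.*-distribˡ-sum _ (summand f g n))
    (R.sum-cong-≋ {suc n} λ i → weight (toℕ i) (n ∸ toℕ i) (m+[n∸m]≡n (toℕ≤pred[n] i)))
    where
    weight : ∀ i j → i ℕ.+ j ≡ n →
             (R.- R.1#) R.^ n R.* (f i R.* g j) R.≈ σ f i R.* σ g j
    weight i j ≡.refl = R.trans (R.*-congʳ (R.^-homo-* (R.- R.1#) i j))
      (R.solve 4 (λ a b c d → (a R.:* b) R.:* (c R.:* d) R.:= (a R.:* c) R.:* (b R.:* d))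
        R.refl _ _ (f i) (g j))

  -- Composition of power series.

  -- Cutting off f (u (t)) at a bound N independent of the degree makes it a
  -- polynomial expression in u.

  private
    truncated : ℕ → Series → Series → Series
    truncated N f u n = R.sum λ (m : Fin N) → f (toℕ m) R.* (u ^ toℕ m) n

    *-sum : ∀ N (c : Fin N → R.Carrier) (h : Fin N → Series) u n →
            R.sum (λ m → c m R.* (u * h m) n) R.≈ (u * λ j → R.sum λ m → c m R.* h m j) n
    *-sum N c h u n = begin
      R.sum (λ m → c m R.* (u * h m) n)
        ≈⟨ R.sum-cong-≋ (λ m → R.*-distribˡ-sum (c m) (summand u (h m) n)) ⟩
      R.sum (λ m → R.sum λ (i : Fin (suc n)) → c m R.* (u (toℕ i) R.* h m (n ∸ toℕ i)))
        ≈⟨ R.∑-comm (λ m i → c m R.* summand u (h m) n i) ⟩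
      R.sum (λ (i : Fin (suc n)) → R.sum λ m → c m R.* (u (toℕ i) R.* h m (n ∸ toℕ i)))
        ≈⟨ R.sum-cong-≋ {suc n} (λ i → R.sum-cong-≋ {N} λ m →
             swap (c m) (u (toℕ i)) (h m (n ∸ toℕ i))) ⟩
      R.sum (λ (i : Fin (suc n)) → R.sum λ m → u (toℕ i) R.* (c m R.* h m (n ∸ toℕ i)))
        ≈⟨ R.sum-cong-≋ {suc n} (λ i → R.*-distribˡ-sum (u (toℕ i)) λ m → c m R.* h m (n ∸ toℕ i)) ⟨
      (u * λ j → R.sum λ m → c m R.* h m j) n ∎
      where
      open ≈-Reasoning R.setoid
      swap : ∀ a b d → a R.* (b R.* d) R.≈ b R.* (a R.* d)
      swap a b d = R.trans (R.sym (R.*-assoc a b d))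
        (R.trans (R.*-congʳ (R.*-comm a b)) (R.*-assoc b a d))

    truncated-suc : ∀ N f u n →
      truncated (suc N) f u n R.≈ f 0 R.* 1# n R.+ (u * truncated N (tail f) u) n
    truncated-suc N f u n = R.+-congˡ (*-sum N _ (λ m → u ^ toℕ m) u n)

    -- Each Horner step lowers both bounds by one, and multiplication by u lowers the relevant
    -- degrees as well, so any bound above the degree gives the same coefficient.
    truncated-stable : ∀ N M f u n → u 0 R.≈ R.0# → n < N → n < M →
                       truncated N f u n R.≈ truncated M f u n
    truncated-stable (suc N) (suc M) f u n u₀≈0 (s≤s n≤N) (s≤s n≤M) = R.trans
      (truncated-suc N f u n) (R.trans
      (R.+-congˡ (*-cong-below u n u₀≈0 λ i i<n →
        truncated-stable N M (tail f) u i u₀≈0 (≤-trans i<n n≤N) (≤-trans i<n n≤M)))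
      (R.sym (truncated-suc M f u n)))

  -- In degree n the bound is n + 1, and splitting off the constant term leaves the bound n for
  -- `tail f`. The factor u looks only at degrees i < n, where this bound may be replaced by the
  -- bound i + 1 of `tail f ∘ u`.
  ∘-horner : ∀ f u → u 0 R.≈ R.0# → f ∘ u ≈ const (f 0) + u * (tail f ∘ u)
  ∘-horner f u u₀≈0 n = R.trans (truncated-suc n f u n) (R.+-cong
    (constant n)
    (*-cong-below u n u₀≈0 λ i i<n →
      truncated-stable n (suc i) (tail f) u i u₀≈0 i<n (n<1+n i)))
    where
    constant : ∀ n → f 0 R.* 1# n R.≈ const (f 0) n
    constant zero    = R.*-identityʳ _
    constant (suc n) = R.zeroʳ _

  ∘-congʳ : ∀ {f g} u → f ≈ g → f ∘ u ≈ g ∘ u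
  ∘-congʳ u eq n = R.sum-cong-≋ {suc n} λ m → R.*-congʳ {(u ^ toℕ m) n} (eq (toℕ m))

  ∘-+ : ∀ f g u → (f + g) ∘ u ≈ f ∘ u + g ∘ u
  ∘-+ f g u n = R.trans
    (R.sum-cong-≋ {suc n} λ m → R.distribʳ ((u ^ toℕ m) n) (f (toℕ m)) (g (toℕ m)))
    (R.∑-distrib-+ {suc n} (λ m → f (toℕ m) R.* (u ^ toℕ m) n)
                           (λ m → g (toℕ m) R.* (u ^ toℕ m) n))

  ∘-coefficient-0 : ∀ f u → (f ∘ u) 0 R.≈ f 0
  ∘-coefficient-0 f u = R.trans (R.+-identityʳ _) (R.*-identityʳ _)

  -- The series with all coefficients 1 is its own tail, so Horner's rule gives r = 1 + (1 - f) r.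
  -- Adding f r to both sides and cancelling r leaves f r = 1.
  reciprocal-inverse : ∀ f → f 0 R.≈ R.1# → f * reciprocal f ≈ 1#
  reciprocal-inverse f f₀≈1 = S.+-cancelʳ r (f * r) 1# (begin
    f * r + r                   ≈⟨ S.+-congˡ {f * r} (∘-horner (λ _ → R.1#) (1# - f) y₀≈0) ⟩
    f * r + (1# + (1# - f) * r) ≈⟨ S.solve 4 (λ f r o y → f S.:* r S.:+ (o S.:+ y S.:* r)
                                     S.:= o S.:+ (f S.:+ y) S.:* r) S.refl f r 1# (1# - f) ⟩
    1# + (f + (1# - f)) * r     ≈⟨ S.+-congˡ (S.*-congʳ (RingLemmas.y+[x-y]≈x commutativeRing 1# f)) ⟩
    1# + 1# * r                 ≈⟨ S.+-congˡ (S.*-identityˡ r) ⟩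
    1# + r                      ∎)
    where
    open ≈-Reasoning S.setoid
    r = reciprocal f
    y₀≈0 : (1# - f) 0 R.≈ R.0#
    y₀≈0 = R.trans (R.+-congˡ (R.-‿cong f₀≈1)) (R.-‿inverseʳ R.1#)

  -- The extra factor u replaces the division in f′(u) θ u = (θ f)(u) θ u / u. Both sides X(f) obey
  -- the same recursion X(f) = u (θ u (tail f ∘ u) + X(tail f)), and u has no constant term, so this
  -- determines every coefficient from lower ones.
  chain-rule : ∀ f u → u 0 R.≈ R.0# → θ (f ∘ u) * u ≈ (θ f ∘ u) * θ u
  chain-rule f u u₀≈0 n = below (suc n) f n (n<1+n n)
    where
    open ≈-Reasoning S.setoid
    left : ∀ f → θ (f ∘ u) * u ≈ u * (θ u * (tail f ∘ u) + θ (tail f ∘ u) * u)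
    left f = begin
      θ (f ∘ u) * u                 ≈⟨ S.*-congʳ (θ-cong (∘-horner f u u₀≈0)) ⟩
      θ (const (f 0) + u * h) * u   ≈⟨ S.*-congʳ (θ-+ (const (f 0)) (u * h)) ⟩
      (θ (const (f 0)) + θ (u * h)) * u
        ≈⟨ S.*-congʳ (S.+-cong (θ-const (f 0)) (θ-* u h)) ⟩
      (0# + (θ u * h + u * θ h)) * u
        ≈⟨ S.solve 4 (λ u u′ h h′ → (S.con 0 S.:+ (u′ S.:* h S.:+ u S.:* h′)) S.:* u
             S.:= u S.:* (u′ S.:* h S.:+ h′ S.:* u)) S.refl u (θ u) h (θ h) ⟩
      u * (θ u * h + θ h * u) ∎
      where h = tail f ∘ u
    right : ∀ f → (θ f ∘ u) * θ u ≈ u * (θ u * (tail f ∘ u) + (θ (tail f) ∘ u) * θ u)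
    right f = begin
      (θ f ∘ u) * θ u               ≈⟨ S.*-congʳ (∘-horner (θ f) u u₀≈0) ⟩
      -- `tail (θ f)` unfolds to `tail f + θ (tail f)`, as (n + 1) × a is a + n × a; the constant
      -- term of `θ f` is 0.
      (const R.0# + u * ((tail f + θ (tail f)) ∘ u)) * θ u
        ≈⟨ S.*-congʳ {θ u} (S.+-congˡ {const R.0#} (S.*-congˡ {u} (∘-+ (tail f) (θ (tail f)) u))) ⟩
      (0# + u * (h + k)) * θ u
        ≈⟨ S.solve 4 (λ u u′ h k → (S.con 0 S.:+ u S.:* (h S.:+ k)) S.:* u′
             S.:= u S.:* (u′ S.:* h S.:+ k S.:* u′)) S.refl u (θ u) h k ⟩
      u * (θ u * h + k * θ u) ∎
      where
      h = tail f ∘ u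
      k = θ (tail f) ∘ u
    below : ∀ N f n → n < N → (θ (f ∘ u) * u) n R.≈ ((θ f ∘ u) * θ u) n
    below (suc N) f n (s≤s n≤N) = R.trans (left f n) (R.trans
      (*-cong-below u n u₀≈0 λ i i<n → R.+-congˡ {(θ u * (tail f ∘ u)) i}
        (below N (tail f) i (≤-trans i<n n≤N)))
      (R.sym (right f n)))

-- Exponential series.

module ExponentialSeries {c ℓ} (R : CommutativeRing c ℓ) where

  private
    module R where
      open CommutativeRing R public
      open SemiringMult semiring public
      open SemiringExp semiring public

  open PowerSeries R.rawRing
  open SeriesOver R

  -- Only the recursion of the inverse factorials is asked of `φ`, so that one proof covers eᵗ and
  -- e⁻ᵗ over the scalars and eˣᵗ over the polynomials.
  θ-exp : ∀ φ → (∀ n → suc n R.× φ (suc n) R.≈ φ n) →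
          ∀ a → θ (exp φ a) ≈ (const a * t) * exp φ a
  θ-exp φ φ-suc a n = R.trans (pointwise n)
    (R.sym (R.trans (*-assoc (const a) t (exp φ a) n) (const-* a (t * exp φ a) n)))
    where
    open ≈-Reasoning R.setoid
    pointwise : ∀ n → θ (exp φ a) n R.≈ a R.* (t * exp φ a) n
    pointwise zero = R.sym (R.trans
      (R.*-congˡ (R.trans (R.+-identityʳ _) (R.zeroˡ _))) (R.zeroʳ a))
    pointwise (suc n) = begin
      suc n R.× (a R.* a R.^ n R.* φ (suc n))  ≈⟨ R.×-comm-* (suc n) (a R.^ suc n) (φ (suc n)) ⟨
      a R.* a R.^ n R.* (suc n R.× φ (suc n))  ≈⟨ R.*-congˡ (φ-suc n) ⟩
      a R.* a R.^ n R.* φ n                    ≈⟨ R.*-assoc a (a R.^ n) (φ n) ⟩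
      a R.* exp φ a n                          ≈⟨ R.*-congˡ (t*-suc (exp φ a) n) ⟨
      a R.* (t * exp φ a) (suc n)              ∎

-- Polynomials as a subring of the power series.

module PolynomialRing {c ℓ} (R : CommutativeRing c ℓ) where

  private
    module R where
      open CommutativeRing R public
      open RingProperties ring public
      open SemiringSum semiring public

  open Polynomials R.rawRing
  private
    module R[[x]] where
      open PowerSeries R.rawRing public
      open SeriesOver R public

  coeff-+ : ∀ p q i → coeff (p + q) i R.≈ coeff p i R.+ coeff q i
  coeff-+ []      q       i       = R.sym (R.+-identityˡ _)
  coeff-+ (a ∷ p) []      i       = R.sym (R.+-identityʳ _)
  coeff-+ (a ∷ p) (b ∷ q) zero    = R.refl
  coeff-+ (a ∷ p) (b ∷ q) (suc i) = coeff-+ p q i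

  coeff-neg : ∀ p i → coeff (- p) i R.≈ R.- coeff p i
  coeff-neg []      i       = R.sym R.-0#≈0#
  coeff-neg (a ∷ p) zero    = R.refl
  coeff-neg (a ∷ p) (suc i) = coeff-neg p i

  coeff-· : ∀ a p i → coeff (a · p) i R.≈ a R.* coeff p i
  coeff-· a []      i       = R.sym (R.zeroʳ a)
  coeff-· a (b ∷ p) zero    = R.refl
  coeff-· a (b ∷ p) (suc i) = coeff-· a p i

  coeff-1# : ∀ i → coeff 1# i R.≈ R[[x]].1# i
  coeff-1# zero    = R.refl
  coeff-1# (suc i) = R.refl

  coeff-* : ∀ p q → coeff (p * q) R[[x]].≈ coeff p R[[x]].* coeff q
  coeff-* []      q i = R.sym (R.trans
    (R.sum-cong-≋ {suc i} λ j → R.zeroˡ (coeff q (i ∸ toℕ j)))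
    (R.sum-replicate-zero (suc i)))
  coeff-* (a ∷ p) q zero    = R.trans (coeff-+ (a · q) _ 0) (R.+-congʳ (coeff-· a q 0))
  coeff-* (a ∷ p) q (suc i) = R.trans (coeff-+ (a · q) _ (suc i))
    (R.+-cong (coeff-· a q (suc i)) (coeff-* p q i))

  -- Equality of polynomials is by definition equality of their coefficient series, so `coeff` is
  -- injective and the ring laws are pulled back from power series instead of being proved on lists.
  coeff-isRingMonomorphism : IsRingMonomorphism rawRing R[[x]].rawRing coeff
  coeff-isRingMonomorphism = record
    { isRingHomomorphism = record
      { isSemiringHomomorphism = record
        { isNearSemiringHomomorphism = record
          { +-isMonoidHomomorphism = record
            { isMagmaHomomorphism = record
              { isRelHomomorphism = record { cong = λ eq → eq }
              ; homo = coeff-+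
              }
            ; ε-homo = λ i → R.sym (R[[x]].const-0# i)
            }
          ; *-homo = coeff-*
          }
        ; 1#-homo = coeff-1#
        }
      ; -‿homo = coeff-neg
      }
    ; injective = λ eq → eq
    }

  commutativeRing : CommutativeRing c ℓ
  commutativeRing = record
    { isCommutativeRing =
        RingMonomorphism.isCommutativeRing coeff-isRingMonomorphism R[[x]].isCommutativeRing
    }

  private module R[x] = CommutativeRing commutativeRing

  const-cong : ∀ {a b} → a R.≈ b → const a ≈ const b
  const-cong eq zero    = eq
  const-cong eq (suc i) = R.refl

  const-0# : const R.0# ≈ 0#
  const-0# zero    = R.refl
  const-0# (suc i) = R.refl

  const-* : ∀ a b → const (a R.* b) ≈ const a * const b
  const-* a b zero    = R.sym (R.+-identityʳ _)
  const-* a b (suc i) = R.refl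

  const-isRingHomomorphism : IsRingHomomorphism R.rawRing rawRing const
  const-isRingHomomorphism = record
    { isSemiringHomomorphism = record
      { isNearSemiringHomomorphism = record
        { +-isMonoidHomomorphism = record
          { isMagmaHomomorphism = record
            { isRelHomomorphism = record { cong = const-cong }
            ; homo = λ _ _ _ → R.refl
            }
          ; ε-homo = const-0#
          }
        ; *-homo = const-*
        }
      ; 1#-homo = λ _ → R.refl
      }
    ; -‿homo = λ _ _ → R.refl
    }

  ·≈const* : ∀ a p → a · p ≈ const a * p
  ·≈const* a p i = R.sym (R.trans (coeff-+ (a · p) (R.0# ∷ []) i)
    (R.trans (R.+-congˡ (const-0# i)) (R.+-identityʳ _)))

-- Logarithmic derivatives in an abstract differential ring.

module DifferentialRing {c ℓ} (S : CommutativeRing c ℓ) where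

  open CommutativeRing S
  open RingLemmas S
  open RingProperties ring
  open SemiringMult semiring
  open SemiringExp semiring
  open ≈-Reasoning setoid
  open SemiringSolver commutativeSemiring using (solve; _:+_; _:*_; _:=_)

  module Derivation
    (θ : Carrier → Carrier)
    (θ-cong : ∀ {a b} → a ≈ b → θ a ≈ θ b)
    (θ-+ : ∀ a b → θ (a + b) ≈ θ a + θ b)
    (θ-* : ∀ a b → θ (a * b) ≈ θ a * b + a * θ b)
    (θ-1# : θ 1# ≈ 0#)
    where

    -- `θ a ≈ v * a` makes v the logarithmic derivative of a without dividing by a; the product rule
    -- then adds logarithmic derivatives.
    log-* : ∀ {a b v w} → θ a ≈ v * a → θ b ≈ w * b → θ (a * b) ≈ (v + w) * (a * b)
    log-* {a} {b} {v} {w} θa θb = begin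
      θ (a * b)                  ≈⟨ θ-* a b ⟩
      θ a * b + a * θ b          ≈⟨ +-cong (*-congʳ θa) (*-congˡ θb) ⟩
      v * a * b + a * (w * b)    ≈⟨ solve 4 (λ a b v w → v :* a :* b :+ a :* (w :* b)
                                      := (v :+ w) :* (a :* b)) refl a b v w ⟩
      (v + w) * (a * b)          ∎

    log-^ : ∀ {a w} m → θ a ≈ w * a → θ (a ^ m) ≈ (m × w) * a ^ m
    log-^ zero    θa = trans θ-1# (sym (zeroˡ 1#))
    log-^ (suc m) θa = log-* θa (log-^ m θa)

    -- Differentiating ab = 1 and multiplying by b gives w b + θ b = 0.
    log-inverse : ∀ {a b w} → a * b ≈ 1# → θ a ≈ w * a → θ b ≈ - w * b
    log-inverse {a} {b} {w} ab≈1 θa = trans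
      (+-inverseʳ-unique (w * b) (θ b) (begin
        w * b + θ b                ≈⟨ +-congˡ (*-identityˡ (θ b)) ⟨
        w * b + 1# * θ b           ≈⟨ +-congˡ (*-congʳ (trans (*-comm b a) ab≈1)) ⟨
        w * b + b * a * θ b        ≈⟨ +-congʳ (*-identityʳ (w * b)) ⟨
        w * b * 1# + b * a * θ b   ≈⟨ +-congʳ (*-congˡ ab≈1) ⟨
        w * b * (a * b) + b * a * θ b
          ≈⟨ solve 4 (λ a b w b′ → w :* b :* (a :* b) :+ b :* a :* b′
               := b :* (w :* a :* b :+ a :* b′)) refl a b w (θ b) ⟩
        b * (w * a * b + a * θ b)  ≈⟨ *-congˡ (+-congʳ (*-congʳ θa)) ⟨
        b * (θ a * b + a * θ b)    ≈⟨ *-congˡ (θ-* a b) ⟨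
        b * θ (a * b)              ≈⟨ *-congˡ (trans (θ-cong ab≈1) θ-1#) ⟩
        b * 0#                     ≈⟨ zeroʳ b ⟩
        0#                         ∎))
      (-‿distribˡ-* w b)

    -- To be read with A = Tʳ, A′ = Tʳ⁺¹, L = Lₖ, L′ = Lₖ₋₁ and w = r (1 - T(-t)). The negative term
    -- is moved to the left, which keeps both sides free of subtraction.
    θ[AL]+A′L≈wAL+A′L′ : ∀ {A A′ L L′ T w} → θ A ≈ w * A → A′ ≈ A * T →
                         θ L + L * T ≈ L′ * T →
                         θ (A * L) + A′ * L ≈ w * (A * L) + A′ * L′
    θ[AL]+A′L≈wAL+A′L′ {A} {A′} {L} {L′} {T} {w} θA A′≈AT θL = begin
      θ (A * L) + A′ * L                     ≈⟨ +-cong (θ-* A L) (*-congʳ A′≈AT) ⟩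
      θ A * L + A * θ L + A * T * L          ≈⟨ +-congʳ (+-congʳ (*-congʳ θA)) ⟩
      w * A * L + A * θ L + A * T * L
        ≈⟨ solve 5 (λ a l l₁ t w → w :* a :* l :+ a :* l₁ :+ a :* t :* l
             := w :* (a :* l) :+ a :* (l₁ :+ l :* t)) refl A L (θ L) T w ⟩
      w * (A * L) + A * (θ L + L * T)        ≈⟨ +-congˡ (*-congˡ θL) ⟩
      w * (A * L) + A * (L′ * T)
        ≈⟨ +-congˡ (solve 3 (λ a l t → a :* (l :* t) := a :* t :* l) refl A L′ T) ⟩
      w * (A * L) + A * T * L′               ≈⟨ +-congˡ (*-congʳ A′≈AT) ⟨
      w * (A * L) + A′ * L′                  ∎

    -- To be read with e₊ = eᵗ, e₋ = e⁻ᵗ, E = (eᵗ - 1)/t, U = (1 - e⁻ᵗ)/t,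
    -- T = 1/E, V = 1/U; for these, e₊ T = T(-t).

    module BernoulliIdentities
      (t : Carrier) (t-cancel : ∀ a b → t * a ≈ t * b → a ≈ b) (θ-t : θ t ≈ t)
      {e₊ e₋ E U T V : Carrier}
      (θe₊ : θ e₊ ≈ t * e₊) (θe₋ : θ e₋ ≈ - t * e₋) (e₊e₋≈1 : e₊ * e₋ ≈ 1#)
      (1+tE≈e₊ : 1# + t * E ≈ e₊) (e₋+tU≈1 : e₋ + t * U ≈ 1#)
      (ET≈1 : E * T ≈ 1#) (UV≈1 : U * V ≈ 1#)
      where

      -- This is eᵗ - 1 = eᵗ (1 - e⁻ᵗ) with the common factor t cancelled.
      E≈e₊U : E ≈ e₊ * U
      E≈e₊U = t-cancel _ _ (+-cancelˡ 1# _ _ (begin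
        1# + t * E             ≈⟨ 1+tE≈e₊ ⟩
        e₊                     ≈⟨ *-identityʳ e₊ ⟨
        e₊ * 1#                ≈⟨ *-congˡ e₋+tU≈1 ⟨
        e₊ * (e₋ + t * U)      ≈⟨ solve 4 (λ e f t u → e :* (f :+ t :* u)
                                    := e :* f :+ t :* (e :* u)) refl e₊ e₋ t U ⟩
        e₊ * e₋ + t * (e₊ * U) ≈⟨ +-congʳ e₊e₋≈1 ⟩
        1# + t * (e₊ * U)      ∎))

      e₋≈UT : e₋ ≈ U * T
      e₋≈UT = begin
        e₋                   ≈⟨ *-identityʳ e₋ ⟨
        e₋ * 1#              ≈⟨ *-congˡ ET≈1 ⟨
        e₋ * (E * T)         ≈⟨ *-congˡ (*-congʳ E≈e₊U) ⟩
        e₋ * (e₊ * U * T)    ≈⟨ solve 4 (λ e f u t → f :* (e :* u :* t)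
                                  := e :* f :* (u :* t)) refl e₊ e₋ U T ⟩
        e₊ * e₋ * (U * T)    ≈⟨ *-congʳ e₊e₋≈1 ⟩
        1# * (U * T)         ≈⟨ *-identityˡ (U * T) ⟩
        U * T                ∎

      -- Applying θ to 1 + t E = eᵗ and cancelling t gives E + θ E = eᵗ; here eᵗ is rewritten as eᵗ
      -- T E to exhibit a multiple of E.
      θE : θ E ≈ (e₊ * T - 1#) * E
      θE = begin
        θ E                     ≈⟨ y+[x-y]≈x (θ E) E ⟨
        E + (θ E - E)           ≈⟨ +-assoc E (θ E) (- E) ⟨
        E + θ E - E             ≈⟨ +-congʳ (t-cancel _ _ t[E+θE]≈te₊) ⟩
        e₊ - E                  ≈⟨ +-cong (*-identityʳ e₊) (-1*x≈-x E) ⟨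
        e₊ * 1# + - 1# * E      ≈⟨ +-congʳ (*-congˡ (trans (*-comm T E) ET≈1)) ⟨
        e₊ * (T * E) + - 1# * E ≈⟨ +-congʳ (*-assoc e₊ T E) ⟨
        e₊ * T * E + - 1# * E   ≈⟨ distribʳ E (e₊ * T) (- 1#) ⟨
        (e₊ * T - 1#) * E       ∎
        where
        t[E+θE]≈te₊ : t * (E + θ E) ≈ t * e₊
        t[E+θE]≈te₊ = begin
          t * (E + θ E)           ≈⟨ distribˡ t E (θ E) ⟩
          t * E + t * θ E         ≈⟨ +-congʳ (*-congʳ θ-t) ⟨
          θ t * E + t * θ E       ≈⟨ θ-* t E ⟨
          θ (t * E)               ≈⟨ +-identityˡ _ ⟨
          0# + θ (t * E)          ≈⟨ +-congʳ θ-1# ⟨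
          θ 1# + θ (t * E)        ≈⟨ θ-+ 1# (t * E) ⟨
          θ (1# + t * E)          ≈⟨ θ-cong 1+tE≈e₊ ⟩
          θ e₊                    ≈⟨ θe₊ ⟩
          t * e₊                  ∎

      θT : θ T ≈ - (e₊ * T - 1#) * T
      θT = log-inverse ET≈1 θE

      -- Since t U = 1 - e⁻ᵗ, its derivative is t e⁻ᵗ, and e⁻ᵗ = U T. This is where T enters the
      -- derivative of Lₖ.
      θ[tU] : θ (t * U) ≈ t * U * T
      θ[tU] = +-cancelˡ (- t * e₋) _ _ (begin
        - t * e₋ + θ (t * U)   ≈⟨ +-congʳ θe₋ ⟨
        θ e₋ + θ (t * U)       ≈⟨ θ-+ e₋ (t * U) ⟨
        θ (e₋ + t * U)         ≈⟨ trans (θ-cong e₋+tU≈1) θ-1# ⟩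
        0#                     ≈⟨ -‿inverseˡ (t * e₋) ⟨
        - (t * e₋) + t * e₋    ≈⟨ +-cong (-‿distribˡ-* t e₋) (*-congˡ e₋≈UT) ⟩
        - t * e₋ + t * (U * T) ≈⟨ +-congˡ (*-assoc t U T) ⟨
        - t * e₋ + t * U * T   ∎)

      -- The factor t is cancellable and U is a unit with inverse V.
      tU-cancel : ∀ a b → t * U * a ≈ t * U * b → a ≈ b
      tU-cancel a b eq = begin
        a            ≈⟨ *-identityˡ a ⟨
        1# * a       ≈⟨ *-congʳ VU≈1 ⟨
        V * U * a    ≈⟨ *-assoc V U a ⟩
        V * (U * a)  ≈⟨ *-congˡ (t-cancel _ _ (trans (sym (*-assoc t U a)) (trans eq (*-assoc t U b)))) ⟩
        V * (U * b)  ≈⟨ *-assoc V U b ⟨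
        V * U * b    ≈⟨ *-congʳ VU≈1 ⟩
        1# * b       ≈⟨ *-identityˡ b ⟩
        b            ∎
        where VU≈1 = trans (*-comm V U) UV≈1

      -- Inverses of U are unique, and E = e₊ U makes e₊ T one of them. It serves to recognize
      -- T(-t).
      e₊T-unique : ∀ {Y} → Y * U ≈ 1# → Y ≈ e₊ * T
      e₊T-unique {Y} YU≈1 = begin
        Y                    ≈⟨ *-identityʳ Y ⟨
        Y * 1#               ≈⟨ *-congˡ ET≈1 ⟨
        Y * (E * T)          ≈⟨ *-congˡ (*-congʳ E≈e₊U) ⟩
        Y * (e₊ * U * T)     ≈⟨ solve 4 (λ y e u t → y :* (e :* u :* t)
                                  := y :* u :* (e :* t)) refl Y e₊ U T ⟩
        Y * U * (e₊ * T)     ≈⟨ *-congʳ YU≈1 ⟩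
        1# * (e₊ * T)        ≈⟨ *-identityˡ (e₊ * T) ⟩
        e₊ * T               ∎

      -- P and P′ stand for Liₖ(u) and Liₖ₋₁(u), and the last hypothesis is the chain rule. Two
      -- factors u are needed: one turns L into P inside the derivative, the other is the one that
      -- the chain rule carries.
      θL+LT≈L′T : ∀ {L L′ P P′} → L * (t * U) ≈ P → L′ * (t * U) ≈ P′ →
                  θ P * (t * U) ≈ P′ * θ (t * U) → θ L + L * T ≈ L′ * T
      θL+LT≈L′T {L} {L′} {P} {P′} Lu≈P L′u≈P′ θPu≈P′θu = tU-cancel _ _ (tU-cancel _ _ (begin
        u * (u * (θ L + L * T))       ≈⟨ solve 4 (λ u L L₁ T → u :* (u :* (L₁ :+ L :* T))
                                           := (L₁ :* u :+ L :* (u :* T)) :* u) refl u L (θ L) T ⟩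
        (θ L * u + L * (u * T)) * u   ≈⟨ *-congʳ (+-congˡ (*-congˡ θ[tU])) ⟨
        (θ L * u + L * θ u) * u       ≈⟨ *-congʳ (θ-* L u) ⟨
        θ (L * u) * u                 ≈⟨ *-congʳ (θ-cong Lu≈P) ⟩
        θ P * u                       ≈⟨ θPu≈P′θu ⟩
        P′ * θ u                      ≈⟨ *-cong (sym L′u≈P′) θ[tU] ⟩
        L′ * u * (u * T)              ≈⟨ solve 3 (λ L u T → L :* u :* (u :* T)
                                           := u :* (u :* (L :* T))) refl L′ u T ⟩
        u * (u * (L′ * T))            ∎))
        where u = t * U

-- Division by positive integers.

module ℚAlgebraProperties {c ℓ} (K : ℚAlgebra c ℓ) where

  open ℚAlgebra K hiding (_×_; _^_; sum)
  open RingLemmas commutativeRing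
  open SemiringMult semiring
  open ≈-Reasoning setoid

  n×1/n≈1 : ∀ n .{{_ : ℕ.NonZero n}} → n × (1/ n) ≈ 1#
  n×1/n≈1 n = trans (×≈×1* n (1/ n)) (1/-inverse n)

  1/n*n×x≈x : ∀ n .{{_ : ℕ.NonZero n}} x → (1/ n) * (n × x) ≈ x
  1/n*n×x≈x n x = begin
    (1/ n) * (n × x)         ≈⟨ ×-comm-* n (1/ n) x ⟩
    n × ((1/ n) * x)         ≈⟨ ×-assoc-* n (1/ n) x ⟨
    (n × (1/ n)) * x         ≈⟨ *-congʳ (n×1/n≈1 n) ⟩
    1# * x                   ≈⟨ *-identityˡ x ⟩
    x                        ∎

  ×-cancel : ∀ n .{{_ : ℕ.NonZero n}} {x y} → n × x ≈ n × y → x ≈ y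
  ×-cancel n {x} {y} eq = trans (sym (1/n*n×x≈x n x)) (trans (*-congˡ eq) (1/n*n×x≈x n y))

-- The series T and Lₖ and their derivatives over the scalars.

module MixedTypeSeries {c ℓ} (K : ℚAlgebra c ℓ) where

  open MixedType K

  private
    module K where
      open ℚAlgebra K public hiding (_×_; _^_; sum)
      open RingProperties ring public
      open RingLemmas commutativeRing public
      open SemiringMult semiring public
      open SemiringExp semiring public
      open ℚAlgebraProperties K public

  open PowerSeries K.rawRing
  open SeriesOver K.commutativeRing
  open ExponentialSeries K.commutativeRing

  private
    module S where
      open CommutativeRing commutativeRing public
      open RingProperties ring public
      open RingLemmas commutativeRing public
      open SemiringExp semiring public using (^-homo-*)
      open SemiringMult semiring public using (_×_)
      open SemiringSolver commutativeSemiring public using (solve; _:+_; _:*_; _:=_)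

  open DifferentialRing commutativeRing
  open Derivation θ θ-cong θ-+ θ-* (θ-const K.1#)

  1/!-zero : 1/! 0 K.≈ K.1#
  1/!-zero = K.trans (K.sym (K.+-identityʳ _)) (K.n×1/n≈1 1)

  1/!-suc : ∀ n → suc n K.× 1/! (suc n) K.≈ 1/! n
  1/!-suc n = K.×-cancel (n !) {{n !≢0}} (begin
    (n !) K.× (suc n K.× 1/! (suc n))   ≈⟨ K.×-assocˡ _ (n !) (suc n) ⟩
    (n ! ℕ.* suc n) K.× 1/! (suc n)     ≈⟨ K.×-congˡ (ℕ.*-comm (n !) (suc n)) ⟩
    (suc n !) K.× 1/! (suc n)           ≈⟨ K.n×1/n≈1 (suc n !) {{suc n !≢0}} ⟩
    K.1#                                ≈⟨ K.n×1/n≈1 (n !) {{n !≢0}} ⟨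
    (n !) K.× 1/! n                     ∎)
    where open ≈-Reasoning K.setoid

  θ≈0⇒constant : ∀ f → θ f ≈ 0# → f ≈ const (f 0)
  θ≈0⇒constant f eq zero    = K.refl
  θ≈0⇒constant f eq (suc n) =
    K.×-cancel (suc n) (K.trans (eq (suc n)) (K.sym (×-zeroʳ (suc n))))

  e₊ e₋ u E U T : Series
  e₊ = e^[ K.1# t]
  e₋ = e^[ K.- K.1# t]
  u = 1# - e₋
  E = tail (e₊ - 1#)
  U = tail u
  T = t/[e^t-1]

  exp-coefficient-0 : ∀ a → e^[ a t] 0 K.≈ K.1#
  exp-coefficient-0 a = K.trans (K.*-identityˡ _) 1/!-zero

  exp-coefficient-1 : ∀ a → e^[ a t] 1 K.≈ a
  exp-coefficient-1 a = K.trans (K.*-cong (K.*-identityʳ a)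
    (K.trans (K.sym (K.+-identityʳ _)) (K.trans (1/!-suc 0) 1/!-zero))) (K.*-identityʳ a)

  θe₊ : θ e₊ ≈ t * e₊
  θe₊ = S.trans (θ-exp 1/! 1/!-suc K.1#) (*-cong {g = e₊} (*-identityˡ t) S.refl)

  const[-1]*t≈-t : const (K.- K.1#) * t ≈ - t
  const[-1]*t≈-t n = K.trans (const-* (K.- K.1#) t n) (K.-1*x≈-x (t n))

  θe₋ : θ e₋ ≈ - t * e₋
  θe₋ = S.trans (θ-exp 1/! 1/!-suc (K.- K.1#)) (*-cong {g = e₋} const[-1]*t≈-t S.refl)

  -- The logarithmic derivative of the product is t - t = 0. As positive integers are cancellable,
  -- the product is constant, and its constant term is 1; no binomial expansion is involved.
  e₊*e₋≈1 : e₊ * e₋ ≈ 1#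
  e₊*e₋≈1 = S.trans (θ≈0⇒constant (e₊ * e₋) θ[e₊e₋]≈0) (λ { zero → constant; (suc n) → K.refl })
    where
    θ[e₊e₋]≈0 : θ (e₊ * e₋) ≈ 0#
    θ[e₊e₋]≈0 = S.trans (log-* {e₊} {e₋} {t} {(- t)} θe₊ θe₋)
      (S.trans (*-cong {g = e₊ * e₋} (S.-‿inverseʳ t) S.refl) (S.zeroˡ (e₊ * e₋)))
    constant : (e₊ * e₋) 0 K.≈ K.1#
    constant = K.trans (K.+-identityʳ _)
      (K.trans (K.*-cong (exp-coefficient-0 K.1#) (exp-coefficient-0 (K.- K.1#))) (K.*-identityˡ K.1#))

  1+t*E≈e₊ : 1# + t * E ≈ e₊
  1+t*E≈e₊ = S.trans (S.+-congˡ {1#} (t*tail (e₊ - 1#)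
    (K.trans (K.+-congʳ (exp-coefficient-0 K.1#)) (K.-‿inverseʳ K.1#))))
    (S.y+[x-y]≈x e₊ 1#)

  u₀≈0 : u 0 K.≈ K.0#
  u₀≈0 = K.trans (K.+-congˡ (K.-‿cong (exp-coefficient-0 (K.- K.1#)))) (K.-‿inverseʳ K.1#)

  t*U≈u : t * U ≈ u
  t*U≈u = t*tail u u₀≈0

  e₋+t*U≈1 : e₋ + t * U ≈ 1#
  e₋+t*U≈1 = S.trans (S.+-congˡ {e₋} t*U≈u) (S.y+[x-y]≈x 1# e₋)

  U₀≈1 : U 0 K.≈ K.1#
  U₀≈1 = K.trans (K.+-identityˡ _) (K.trans (K.-‿cong (exp-coefficient-1 (K.- K.1#)))
    (K.-‿involutive K.1#))

  E₀≈1 : E 0 K.≈ K.1#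
  E₀≈1 = K.trans (K.+-congˡ K.-0#≈0#) (K.trans (K.+-identityʳ _) (exp-coefficient-1 K.1#))

  T≈reciprocal[E] : T ≈ reciprocal E
  T≈reciprocal[E] = S.trans
    (*-cong {tail t} {1#} {reciprocal E} (λ { zero → K.refl ; (suc n) → K.refl }) S.refl)
    (*-identityˡ (reciprocal E))

  E*T≈1 : E * T ≈ 1#
  E*T≈1 = S.trans (*-cong {E} {E} {T} S.refl T≈reciprocal[E]) (reciprocal-inverse E E₀≈1)

  V : Series
  V = reciprocal U

  open BernoulliIdentities t t*-cancel θ-t {e₊} {e₋} {E} {U} {T} {V} θe₊ θe₋ e₊*e₋≈1
    1+t*E≈e₊ e₋+t*U≈1 E*T≈1 (reciprocal-inverse U U₀≈1)

  L : ℤ → Series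
  L = Li[1-e^-t]/[1-e^-t]

  θ-Li : ∀ k → θ (Li k) ≈ Li (k ℤ.- 1ℤ)
  θ-Li k              zero    = K.refl
  -- Here k passes from 0 to -1, where the coefficients change from powers of the inverse to powers
  -- of the integer itself.
  θ-Li (+ zero)       (suc n) = K.sym (K.*-identityʳ _)
  θ-Li (+ suc m)      (suc n) = begin
    suc n K.× ((K.1/ suc n) K.* (K.1/ suc n) K.^ m)   ≈⟨ K.×-assoc-* (suc n) (K.1/ suc n) _ ⟨
    (suc n K.× (K.1/ suc n)) K.* (K.1/ suc n) K.^ m   ≈⟨ K.*-congʳ (K.n×1/n≈1 (suc n)) ⟩
    K.1# K.* (K.1/ suc n) K.^ m                       ≈⟨ K.*-identityˡ _ ⟩
    (K.1/ suc n) K.^ m                                ∎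
    where open ≈-Reasoning K.setoid
  -- The difference `-[1+ m ] - 1ℤ` computes to an index containing `m + 0`, hence the correction of
  -- the exponent.
  θ-Li (-[1+ m ])     (suc n) = K.trans (K.×≈×1* (suc n) _)
    (K.^-congʳ (suc n K.× K.1#) {suc (suc m)} (≡.cong (λ j → suc (suc j)) (≡.sym (ℕ.+-identityʳ m))))

  L*[tU]≈Li∘u : ∀ k → L k * (t * U) ≈ Li k ∘ u
  L*[tU]≈Li∘u k = begin
    tail P * V * (t * U)    ≈⟨ S.solve 4 (λ p v t u → p S.:* v S.:* (t S.:* u)
                                 S.:= t S.:* p S.:* (u S.:* v)) S.refl (tail P) V t U ⟩
    t * tail P * (U * V)    ≈⟨ S.*-congˡ {t * tail P} (reciprocal-inverse U U₀≈1) ⟩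
    t * tail P * 1#         ≈⟨ S.*-identityʳ (t * tail P) ⟩
    t * tail P              ≈⟨ t*tail P (∘-coefficient-0 (Li k) u) ⟩
    P                       ∎
    where
    open ≈-Reasoning S.setoid
    P = Li k ∘ u

  θ[Li∘u]*[tU] : ∀ k → θ (Li k ∘ u) * (t * U) ≈ (Li (k ℤ.- 1ℤ) ∘ u) * θ (t * U)
  θ[Li∘u]*[tU] k = begin
    θ (Li k ∘ u) * (t * U)               ≈⟨ S.*-congˡ {θ (Li k ∘ u)} t*U≈u ⟩
    θ (Li k ∘ u) * u                     ≈⟨ chain-rule (Li k) u u₀≈0 ⟩
    (θ (Li k) ∘ u) * θ u                 ≈⟨ *-cong {θ (Li k) ∘ u} {_} {θ u} (∘-congʳ u (θ-Li k))
                                              (θ-cong (S.sym t*U≈u)) ⟩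
    (Li (k ℤ.- 1ℤ) ∘ u) * θ (t * U)      ∎
    where open ≈-Reasoning S.setoid

  θL : ∀ k → θ (L k) + L k * T ≈ L (k ℤ.- 1ℤ) * T
  θL k = θL+LT≈L′T {L k} {L (k ℤ.- 1ℤ)} {Li k ∘ u} {Li (k ℤ.- 1ℤ) ∘ u}
    (L*[tU]≈Li∘u k) (L*[tU]≈Li∘u (k ℤ.- 1ℤ)) (θ[Li∘u]*[tU] k)

  -- Substituting -t in (eᵗ - 1)/t gives (1 - e⁻ᵗ)/t; on coefficients this is (-1)ⁿ = -(-1)ⁿ⁺¹.
  σE≈U : σ E ≈ U
  σE≈U n = begin
    ε K.* (K.1# K.^ suc n K.* 1/! (suc n) K.+ K.- K.0#)
      ≈⟨ K.*-congˡ (K.trans (K.+-cong (K.*-congʳ (1^ (suc n))) K.-0#≈0#) (K.+-identityʳ _)) ⟩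
    ε K.* (K.1# K.* 1/! (suc n))               ≈⟨ K.*-congˡ (K.*-identityˡ _) ⟩
    ε K.* 1/! (suc n)                          ≈⟨ K.-‿involutive _ ⟨
    K.- K.- (ε K.* 1/! (suc n))                ≈⟨ K.-‿cong (K.-‿distribˡ-* ε _) ⟩
    K.- (K.- ε K.* 1/! (suc n))                ≈⟨ K.-‿cong (K.*-congʳ (K.-1*x≈-x ε)) ⟨
    K.- (K.- K.1# K.* ε K.* 1/! (suc n))       ≈⟨ K.+-identityˡ _ ⟨
    K.0# K.+ K.- (K.- K.1# K.* ε K.* 1/! (suc n)) ∎
    where
    open ≈-Reasoning K.setoid
    ε = (K.- K.1#) K.^ n
    1^ : ∀ n → K.1# K.^ n K.≈ K.1#
    1^ zero    = K.refl
    1^ (suc n) = K.trans (K.*-identityˡ _) (1^ n)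

  -- As σ is multiplicative, σ T is inverse to σ E = U. The product eᵗ T thereby becomes a series
  -- whose coefficients are signed Bernoulli numbers over factorials.
  σT≈e₊T : σ T ≈ e₊ * T
  σT≈e₊T = e₊T-unique {σ T} (begin
    σ T * U         ≈⟨ S.*-congˡ {σ T} σE≈U ⟨
    σ T * σ E       ≈⟨ σ-* T E ⟨
    σ (T * E)       ≈⟨ (λ n → K.*-congˡ (S.trans (*-comm T E) E*T≈1 n)) ⟩
    σ 1#            ≈⟨ (λ { zero → K.*-identityˡ K.1# ; (suc n) → K.zeroʳ _ }) ⟩
    1#              ∎)
    where open ≈-Reasoning S.setoid

  T₀≈1 : T 0 K.≈ K.1#
  T₀≈1 = K.trans (T≈reciprocal[E] 0) (∘-coefficient-0 (λ _ → K.1#) (1# - E))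

  -- W = θ T / T = 1 - T(-t)

  W : Series
  W = - (e₊ * T - 1#)

  -- This removes the term l = n + 1 from the product with the generating function, which is why the
  -- Bernoulli sum stops at l = n.
  W-coefficient-0 : W 0 K.≈ K.0#
  W-coefficient-0 = begin
    K.- ((e₊ * T) 0 K.+ K.- K.1#)      ≈⟨ K.-‿cong (K.+-congʳ (σT≈e₊T 0)) ⟨
    K.- (K.1# K.* T 0 K.+ K.- K.1#)
      ≈⟨ K.-‿cong (K.+-congʳ (K.trans (K.*-identityˡ (T 0)) T₀≈1)) ⟩
    K.- (K.1# K.+ K.- K.1#)            ≈⟨ K.-‿cong (K.-‿inverseʳ K.1#) ⟩
    K.- K.0#                           ≈⟨ K.-0#≈0# ⟩
    K.0#                               ∎
    where open ≈-Reasoning K.setoid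

  W-coefficient-suc : ∀ n → W (suc n) K.≈ K.- ((K.- K.1#) K.^ suc n K.* T (suc n))
  W-coefficient-suc n = K.-‿cong (K.trans
    (K.+-cong (K.sym (σT≈e₊T (suc n))) K.-0#≈0#) (K.+-identityʳ _))

  scale : ℤ → Series → Series
  scale r f n = fromℤ r K.* f n

  T*reciprocal[T]≈1 : T * reciprocal T ≈ 1#
  T*reciprocal[T]≈1 = reciprocal-inverse T T₀≈1

  θ[T^ℤ] : ∀ r → θ (T ^ℤ r) ≈ scale r W * (T ^ℤ r)
  θ[T^ℤ] (+ m) = S.trans (log-^ {T} {W} m θT)
    (S.*-congʳ {T ^ m} λ n → K.trans (×-coefficient m W n) (K.×≈×1* m (W n)))
  -- Negative powers are powers of `reciprocal T`, with logarithmic derivative -W; the sign is then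
  -- moved into the scalar r.
  θ[T^ℤ] -[1+ m ] = S.trans
    (log-^ {reciprocal T} {(- W)} (suc m)
      (log-inverse {T} {reciprocal T} {W} T*reciprocal[T]≈1 θT))
    (S.*-congʳ {reciprocal T ^ suc m} λ n → begin
      (suc m S.× (- W)) n                ≈⟨ ×-coefficient (suc m) (- W) n ⟩
      suc m K.× (K.- W n)                ≈⟨ K.×≈×1* (suc m) (K.- W n) ⟩
      (suc m K.× K.1#) K.* (K.- W n)     ≈⟨ K.-‿distribʳ-* _ (W n) ⟨
      K.- ((suc m K.× K.1#) K.* W n)     ≈⟨ K.-‿distribˡ-* _ (W n) ⟩
      K.- (suc m K.× K.1#) K.* W n       ∎)
    where open ≈-Reasoning K.setoid

  T^ℤ-suc : ∀ r → T ^ℤ (r ℤ.+ 1ℤ) ≈ (T ^ℤ r) * T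
  T^ℤ-suc (+ m) = S.trans (S.^-homo-* T m 1) (S.*-congˡ {T ^ m} (S.*-identityʳ T))
  T^ℤ-suc -[1+ zero ] = S.sym (S.trans (S.*-congʳ {T} (S.*-identityʳ (reciprocal T)))
    (S.trans (*-comm (reciprocal T) T) T*reciprocal[T]≈1))
  T^ℤ-suc -[1+ suc m ] = begin
    X                        ≈⟨ S.*-identityʳ X ⟨
    X * 1#                   ≈⟨ S.*-congˡ {X} T*reciprocal[T]≈1 ⟨
    X * (T * reciprocal T)   ≈⟨ S.solve 3 (λ x t y → x S.:* (t S.:* y) S.:= y S.:* x S.:* t)
                                  S.refl X T (reciprocal T) ⟩
    reciprocal T * X * T     ∎
    where
    open ≈-Reasoning S.setoid
    X = reciprocal T ^ suc m

  θ[T^ℤ*L] : ∀ r k → θ ((T ^ℤ r) * L k) + (T ^ℤ (r ℤ.+ 1ℤ)) * L k ≈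
             scale r W * ((T ^ℤ r) * L k) + (T ^ℤ (r ℤ.+ 1ℤ)) * L (k ℤ.- 1ℤ)
  θ[T^ℤ*L] r k = θ[AL]+A′L≈wAL+A′L′
    {T ^ℤ r} {T ^ℤ (r ℤ.+ 1ℤ)} {L k} {L (k ℤ.- 1ℤ)} {T} {scale r W}
    (θ[T^ℤ] r) (T^ℤ-suc r) (θL k)

  -- From (n + 1) n! = (n + 1)! = C(n+1, l) l! (n+1-l)!: the factor n + 1 is paid for by r/(n+1), l!
  -- belongs to the polynomial with index l, and (n+1-l)! turns a coefficient of T into a Bernoulli
  -- number.
  binomial-weight : ∀ r n l → l ℕ.≤ n →
    (n !) K.× (fromℤ r K.* W (suc n ∸ l)) K.≈
    (K.- (fromℤ r K.* (K.1/ suc n))) K.*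
      ((l !) K.× (((suc n C l) K.× K.1#) K.* ((K.- K.1#) K.^ (suc n ∸ l)) K.* B (suc n ∸ l)))
  binomial-weight r n l l≤n = begin
    (n !) K.× (a K.* W (suc n ∸ l))
      ≈⟨ K.×-congʳ (n !) (K.*-congˡ W≈-y) ⟩
    (n !) K.× (a K.* K.- y)
      ≈⟨ K.×-congʳ (n !) (K.trans (K.sym (K.-‿distribʳ-* a y)) (K.-‿distribˡ-* a y)) ⟩
    (n !) K.× (K.- a K.* y)
      ≈⟨ K.×-comm-* (n !) (K.- a) y ⟨
    K.- a K.* ((n !) K.× y)
      ≈⟨ K.*-congˡ (K.1/n*n×x≈x (suc n) ((n !) K.× y)) ⟨
    K.- a K.* (q K.* (suc n K.× ((n !) K.× y)))
      ≈⟨ K.*-assoc (K.- a) q _ ⟨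
    K.- a K.* q K.* (suc n K.× ((n !) K.× y))
      ≈⟨ K.*-cong (K.sym (K.-‿distribˡ-* a q)) (K.×-assocˡ y (suc n) (n !)) ⟩
    K.- (a K.* q) K.* ((suc n !) K.× y)
      ≈⟨ K.*-congˡ factorials ⟩
    K.- (a K.* q) K.* ((l !) K.× ((d K.× K.1#) K.* ε K.* ((m !) K.× T m))) ∎
    where
    open ≈-Reasoning K.setoid
    m = suc n ∸ l
    a = fromℤ r
    q = K.1/ suc n
    d = suc n C l
    ε = (K.- K.1#) K.^ m
    y = ε K.* T m
    W≈-y : W m K.≈ K.- y
    -- Since l ≤ n the index is positive, so the constant 1 in W = 1 - T(-t) does not contribute.
    W≈-y rewrite ℕ.+-∸-assoc 1 l≤n = W-coefficient-suc (n ∸ l)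
    rearrange : ∀ d i j → d ℕ.* (i ℕ.* j) ≡ i ℕ.* (j ℕ.* d)
    rearrange d i j = ≡.trans (ℕ.*-comm d (i ℕ.* j)) (ℕ.*-assoc i j d)
    factorials : (suc n !) K.× y K.≈ (l !) K.× ((d K.× K.1#) K.* ε K.* ((m !) K.× T m))
    factorials = begin
      (suc n !) K.× y
        ≈⟨ K.×-congˡ (nCk*[k!*[n∸k]!]≡n! (ℕ.m≤n⇒m≤1+n l≤n)) ⟨
      (d ℕ.* (l ! ℕ.* m !)) K.× y
        ≈⟨ K.×-congˡ (rearrange d (l !) (m !)) ⟩
      (l ! ℕ.* (m ! ℕ.* d)) K.× y
        ≈⟨ K.×-assocˡ y (l !) (m ! ℕ.* d) ⟨
      (l !) K.× ((m ! ℕ.* d) K.× y)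
        ≈⟨ K.×-congʳ (l !) (K.×-assocˡ y (m !) d) ⟨
      (l !) K.× ((m !) K.× (d K.× y))
        ≈⟨ K.×-congʳ (l !) (K.×-congʳ (m !) (K.trans (K.×≈×1* d y) (K.sym (K.*-assoc _ ε (T m))))) ⟩
      (l !) K.× ((m !) K.× ((d K.× K.1#) K.* ε K.* T m))
        ≈⟨ K.×-congʳ (l !) (K.×-comm-* (m !) _ (T m)) ⟨
      (l !) K.× ((d K.× K.1#) K.* ε K.* ((m !) K.× T m)) ∎

-- The generating function and its coefficients.

-- P will be K[x] and φ the inclusion of constants. P is kept abstract because
-- equality of polynomials unfolds to coefficients, from which implicit
-- polynomial arguments cannot be inferred.

module Recurrence {c ℓ c′ ℓ′} (K : ℚAlgebra c ℓ) (P : CommutativeRing c′ ℓ′)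
  {φ : ℚAlgebra.Carrier K → CommutativeRing.Carrier P}
  (φ-isRingHomomorphism :
    IsRingHomomorphism (ℚAlgebra.rawRing K) (CommutativeRing.rawRing P) φ)
  (x : CommutativeRing.Carrier P)
  where

  private
    module K = ℚAlgebra K
    module P = CommutativeRing P
  open MixedType K using (1/!; fromℤ; B; t/[e^t-1]; Li[1-e^-t]/[1-e^-t])

  private
    module M = MixedTypeSeries K
    module K[[t]] where
      open PowerSeries K.rawRing public
      open SeriesOver K.commutativeRing public
    module Kₚ where
      open SemiringMult K.semiring public
      open SemiringSum K.semiring public
      open SemiringExp K.semiring public
      open ℚAlgebraProperties K public
    module Pₚ where
      open SemiringMult P.semiring public
      open SemiringSum P.semiring public
      open RingProperties P.ring public
      open RingLemmas P public
      open CommutativeMonoidMult P.+-commutativeMonoid public using (×-distrib-+)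

  open IsRingHomomorphism φ-isRingHomomorphism
    using (+-homo; *-homo; 0#-homo; 1#-homo; -‿homo; ⟦⟧-cong)

  open PowerSeries P.rawRing
  open SeriesOver P
  private
    module S where
      open CommutativeRing commutativeRing public
      open SemiringSolver commutativeSemiring public
        using (solve; _:+_; _:*_; _:=_)

  ×-homo : ∀ n a → φ (n Kₚ.× a) P.≈ n Pₚ.× φ a
  ×-homo zero    a = 0#-homo
  ×-homo (suc n) a = P.trans (+-homo a _) (P.+-congˡ (×-homo n a))

  sum-homo : ∀ {n} (v : Fin n → K.Carrier) → φ (Kₚ.sum v) P.≈ Pₚ.sum (λ i → φ (v i))
  sum-homo {zero}  v = 0#-homo
  sum-homo {suc n} v = P.trans (+-homo _ _) (P.+-congˡ (sum-homo (λ i → v (suc i))))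

  embed : K[[t]].Series → Series
  embed f n = φ (f n)

  embed-* : ∀ f g → embed (f K[[t]].* g) ≈ embed f * embed g
  embed-* f g n = P.trans (sum-homo (K[[t]].summand f g n))
    (Pₚ.sum-cong-≋ {suc n} λ i → *-homo (f (toℕ i)) (g (n ∸ toℕ i)))

  embed-*+* : ∀ f g h k → embed (f K[[t]].* g K[[t]].+ h K[[t]].* k)
                        ≈ embed f * embed g + embed h * embed k
  embed-*+* f g h k n = P.trans (+-homo _ _) (P.+-cong (embed-* f g n) (embed-* h k n))

  e^xt : Series
  e^xt = exp (λ n → φ (1/! n)) x

  θe^xt : θ e^xt ≈ (const x * t) * e^xt
  θe^xt = ExponentialSeries.θ-exp P (λ n → φ (1/! n))
    (λ n → P.trans (P.sym (×-homo (suc n) _)) (⟦⟧-cong (M.1/!-suc n))) x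

  -- When P is K[x] and φ is `const`, this unfolds to `generating`, so the abstract recurrence
  -- specializes without any conversion.
  G : ℤ → ℤ → Series
  G r k = embed (t/[e^t-1] K[[t]].^ℤ r) * embed (Li[1-e^-t]/[1-e^-t] k) * e^xt

  θG : ∀ r k → θ (G r k) + G (r ℤ.+ 1ℤ) k ≈
       embed (M.scale r M.W) * G r k + G (r ℤ.+ 1ℤ) (k ℤ.- 1ℤ) + const x * (t * G r k)
  θG r k = begin
    θ (A * L * e^xt) + A′ * L * e^xt
      ≈⟨ S.+-congʳ {A′ * L * e^xt} (θ-* (A * L) e^xt) ⟩
    θ (A * L) * e^xt + A * L * θ e^xt + A′ * L * e^xt
      ≈⟨ S.+-congʳ {A′ * L * e^xt} (S.+-congˡ {θ (A * L) * e^xt} (S.*-congˡ {A * L} θe^xt)) ⟩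
    θ (A * L) * e^xt + A * L * ((const x * t) * e^xt) + A′ * L * e^xt
      ≈⟨ S.solve 7 (λ f f′ a l e c t →
           f′ S.:* e S.:+ f S.:* ((c S.:* t) S.:* e) S.:+ a S.:* l S.:* e
           S.:= (f′ S.:+ a S.:* l) S.:* e S.:+ c S.:* (t S.:* (f S.:* e)))
         S.refl (A * L) (θ (A * L)) A′ L e^xt (const x) t ⟩
    (θ (A * L) + A′ * L) * e^xt + const x * (t * (A * L * e^xt))
      ≈⟨ S.+-congʳ {const x * (t * (A * L * e^xt))} (S.*-congʳ {e^xt} embedded) ⟩
    (w * (A * L) + A′ * L′) * e^xt + const x * (t * (A * L * e^xt))
      ≈⟨ S.+-congʳ {const x * (t * (A * L * e^xt))} (S.solve 5 (λ w f a l e →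
           (w S.:* f S.:+ a S.:* l) S.:* e S.:= w S.:* (f S.:* e) S.:+ a S.:* l S.:* e)
         S.refl w (A * L) A′ L′ e^xt) ⟩
    w * (A * L * e^xt) + A′ * L′ * e^xt + const x * (t * (A * L * e^xt)) ∎
    where
    open ≈-Reasoning S.setoid
    a = t/[e^t-1] K[[t]].^ℤ r
    a′ = t/[e^t-1] K[[t]].^ℤ (r ℤ.+ 1ℤ)
    l = Li[1-e^-t]/[1-e^-t] k
    l′ = Li[1-e^-t]/[1-e^-t] (k ℤ.- 1ℤ)
    A = embed a
    A′ = embed a′
    L = embed l
    L′ = embed l′
    w = embed (M.scale r M.W)
    -- The factors other than eˣᵗ have scalar coefficients, so their identity is the image under φ
    -- of the one over K.
    embedded : θ (A * L) + A′ * L ≈ w * (A * L) + A′ * L′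
    embedded = begin
      θ (A * L) + A′ * L
        ≈⟨ (λ n → P.+-cong
             (P.trans (×-homo n ((a K[[t]].* l) n)) (Pₚ.×-congʳ n (embed-* a l n)))
             (embed-* a′ l n)) ⟨
      (λ n → φ (K[[t]].θ (a K[[t]].* l) n) P.+ φ ((a′ K[[t]].* l) n))
        ≈⟨ (λ n → +-homo _ _) ⟨
      embed (K[[t]].θ (a K[[t]].* l) K[[t]].+ a′ K[[t]].* l)
        ≈⟨ (λ n → ⟦⟧-cong (M.θ[T^ℤ*L] r k n)) ⟩
      embed (M.scale r M.W K[[t]].* (a K[[t]].* l) K[[t]].+ a′ K[[t]].* l′)
        ≈⟨ embed-*+* (M.scale r M.W) (a K[[t]].* l) a′ l′ ⟩
      w * embed (a K[[t]].* l) + A′ * L′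
        ≈⟨ S.+-congʳ {A′ * L′} (S.*-congˡ {w} (embed-* a l)) ⟩
      w * (A * L) + A′ * L′ ∎

  s : ℤ → ℤ → ℕ → P.Carrier
  s r k n = (n !) Pₚ.× G r k n

  weight : ℕ → ℕ → K.Carrier
  weight n l = ((suc n C l) Kₚ.× K.1#) K.* ((K.- K.1#) Kₚ.^ (suc n ∸ l)) K.* B (suc n ∸ l)

  bernoulli-sum : ∀ r k n →
    (n !) Pₚ.× (embed (M.scale r M.W) * G r k) (suc n) P.≈
    P.- (φ (fromℤ r K.* (K.1/ suc n)) P.*
      Pₚ.sum λ (l : Fin (suc n)) → φ (weight n (toℕ l)) P.* s r k (toℕ l))
  bernoulli-sum r k n = begin
    (n !) Pₚ.× (w * g) (suc n)
      -- Of the n + 2 summands in degree n + 1, the last has the factor `w 0`, which vanishes; those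
      -- with l ≤ n remain.
      ≈⟨ Pₚ.×-congʳ (n !) (P.trans (*-comm w g (suc n)) (*-suc g w n)) ⟩
    (n !) Pₚ.× ((g * tail w) n P.+ g (suc n) P.* w 0)
      ≈⟨ Pₚ.×-congʳ (n !)
           (P.trans (P.+-congˡ (P.trans (P.*-congˡ w₀≈0) (P.zeroʳ _))) (P.+-identityʳ _)) ⟩
    (n !) Pₚ.× (g * tail w) n
      ≈⟨ ×-sum (n !) (summand g (tail w) n) ⟩
    (Pₚ.sum λ (l : Fin (suc n)) → (n !) Pₚ.× (g (toℕ l) P.* w (suc (n ∸ toℕ l))))
      ≈⟨ Pₚ.sum-cong-≋ {suc n} (λ l → term (toℕ l) (toℕ≤pred[n] l)) ⟩
    (Pₚ.sum λ (l : Fin (suc n)) → P.- ρ P.* (φ (weight n (toℕ l)) P.* s r k (toℕ l)))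
      ≈⟨ Pₚ.*-distribˡ-sum (P.- ρ) (λ (l : Fin (suc n)) → φ (weight n (toℕ l)) P.* s r k (toℕ l)) ⟨
    P.- ρ P.* (Pₚ.sum λ (l : Fin (suc n)) → φ (weight n (toℕ l)) P.* s r k (toℕ l))
      ≈⟨ Pₚ.-‿distribˡ-* ρ _ ⟨
    P.- (ρ P.* Pₚ.sum λ (l : Fin (suc n)) → φ (weight n (toℕ l)) P.* s r k (toℕ l)) ∎
    where
    open ≈-Reasoning P.setoid
    w = embed (M.scale r M.W)
    g = G r k
    ρ = φ (fromℤ r K.* (K.1/ suc n))
    w₀≈0 : w 0 P.≈ P.0#
    w₀≈0 = P.trans (⟦⟧-cong (K.trans (K.*-congˡ M.W-coefficient-0) (K.zeroʳ _))) 0#-homo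
    term : ∀ l → l ℕ.≤ n → (n !) Pₚ.× (g l P.* w (suc (n ∸ l))) P.≈
           P.- ρ P.* (φ (weight n l) P.* s r k l)
    term l l≤n = begin
      (n !) Pₚ.× (g l P.* w (suc (n ∸ l)))
        ≈⟨ Pₚ.×-comm-* (n !) (g l) _ ⟨
      g l P.* ((n !) Pₚ.× w (suc (n ∸ l)))
        ≈⟨ P.*-congˡ (×-homo (n !) _) ⟨
      g l P.* φ ((n !) Kₚ.× (fromℤ r K.* M.W (suc (n ∸ l))))
        ≡⟨ ≡.cong (λ m → g l P.* φ ((n !) Kₚ.× (fromℤ r K.* M.W m))) (ℕ.+-∸-assoc 1 l≤n) ⟨
      g l P.* φ ((n !) Kₚ.× (fromℤ r K.* M.W (suc n ∸ l)))
        ≈⟨ P.*-congˡ (⟦⟧-cong (M.binomial-weight r n l l≤n)) ⟩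
      g l P.* φ (K.- (fromℤ r K.* (K.1/ suc n)) K.* ((l !) Kₚ.× weight n l))
        ≈⟨ P.*-congˡ (P.trans (*-homo _ _) (P.*-cong (-‿homo _) (×-homo (l !) _))) ⟩
      g l P.* (P.- ρ P.* ((l !) Pₚ.× φ (weight n l)))
        ≈⟨ P.trans (P.*-comm _ _) (P.*-assoc _ _ _) ⟩
      P.- ρ P.* (((l !) Pₚ.× φ (weight n l)) P.* g l)
        ≈⟨ P.*-congˡ (P.trans (Pₚ.×-assoc-* (l !) _ (g l)) (P.sym (Pₚ.×-comm-* (l !) _ (g l)))) ⟩
      P.- ρ P.* (φ (weight n l) P.* s r k l) ∎

  recurrence : ∀ r k n →
    s r k (suc n) P.≈
      x P.* s r k n
      P.- φ (fromℤ r K.* (K.1/ suc n)) P.*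
          Pₚ.sum (λ (l : Fin (suc n)) → φ (weight n (toℕ l)) P.* s r k (toℕ l))
      P.- φ (K.1/ suc n) P.*
          (s (r ℤ.+ 1ℤ) k (suc n) P.- s (r ℤ.+ 1ℤ) (k ℤ.- 1ℤ) (suc n))
  -- The equation for θ G keeps the series for (r + 1, k) on its left, so its term b is added to
  -- both sides and cancelled.
  recurrence r k n = Pₚ.+-cancelʳ b _ _ (begin
    (suc n !) Pₚ.× g (suc n) P.+ b
      ≈⟨ P.+-congʳ (Pₚ.×-congˡ (ℕ.*-comm (suc n) (n !))) ⟩
    (n ! ℕ.* suc n) Pₚ.× g (suc n) P.+ b
      ≈⟨ P.+-congʳ (Pₚ.×-assocˡ (g (suc n)) (n !) (suc n)) ⟨
    (n !) Pₚ.× θ g (suc n) P.+ b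
      ≈⟨ Pₚ.×-distrib-+ (θ g (suc n)) (G (r ℤ.+ 1ℤ) k (suc n)) (n !) ⟨
    (n !) Pₚ.× (θ g (suc n) P.+ G (r ℤ.+ 1ℤ) k (suc n))
      ≈⟨ Pₚ.×-congʳ (n !) (θG r k (suc n)) ⟩
    (n !) Pₚ.× ((embed (M.scale r M.W) * g) (suc n) P.+ g′ P.+ (const x * (t * g)) (suc n))
      ≈⟨ P.trans (Pₚ.×-distrib-+ _ _ (n !)) (P.+-congʳ (Pₚ.×-distrib-+ _ _ (n !))) ⟩
    (n !) Pₚ.× (embed (M.scale r M.W) * g) (suc n) P.+ b′ P.+ (n !) Pₚ.× (const x * (t * g)) (suc n)
      ≈⟨ P.+-cong (P.+-congʳ (bernoulli-sum r k n)) (Pₚ.×-congʳ (n !)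
           (P.trans (const-* x (t * g) (suc n)) (P.*-congˡ (t*-suc g n)))) ⟩
    P.- Σ P.+ b′ P.+ (n !) Pₚ.× (x P.* g n)
      ≈⟨ P.+-congˡ (Pₚ.×-comm-* (n !) x (g n)) ⟨
    P.- Σ P.+ b′ P.+ x P.* s r k n
      ≈⟨ P.+-comm _ _ ⟩
    x P.* s r k n P.+ (P.- Σ P.+ b′)
      ≈⟨ P.+-assoc _ _ _ ⟨
    x P.* s r k n P.- Σ P.+ b′
      ≈⟨ P.+-congˡ (Pₚ.//-rightDividesˡ b b′) ⟨
    x P.* s r k n P.- Σ P.+ (b′ P.- b P.+ b)
      ≈⟨ P.+-assoc _ _ _ ⟨
    x P.* s r k n P.- Σ P.+ (b′ P.- b) P.+ b
      ≈⟨ P.+-congʳ (P.+-congˡ (Pₚ.⁻¹-anti-homo‿- b b′)) ⟨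
    x P.* s r k n P.- Σ P.- (b P.- b′) P.+ b
      ≈⟨ P.+-congʳ (P.+-congˡ (P.-‿cong (P.+-cong
           (divide (G (r ℤ.+ 1ℤ) k (suc n))) (P.-‿cong (divide g′))))) ⟨
    x P.* s r k n P.- Σ P.- (q P.* s′ P.- q P.* s″) P.+ b
      ≈⟨ P.+-congʳ (P.+-congˡ (P.-‿cong (Pₚ.x[y-z]≈xy-xz q s′ s″))) ⟨
    x P.* s r k n P.- Σ P.- q P.* (s′ P.- s″) P.+ b ∎)
    where
    open ≈-Reasoning P.setoid
    g = G r k
    g′ = G (r ℤ.+ 1ℤ) (k ℤ.- 1ℤ) (suc n)
    b = (n !) Pₚ.× G (r ℤ.+ 1ℤ) k (suc n)
    b′ = (n !) Pₚ.× g′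
    q = φ (K.1/ suc n)
    s′ = s (r ℤ.+ 1ℤ) k (suc n)
    s″ = s (r ℤ.+ 1ℤ) (k ℤ.- 1ℤ) (suc n)
    Σ = φ (fromℤ r K.* (K.1/ suc n)) P.*
          Pₚ.sum (λ (l : Fin (suc n)) → φ (weight n (toℕ l)) P.* s r k (toℕ l))
    -- Scaling degree n + 1 by n!, the right factor for θ G and for x t G, leaves the terms with r +
    -- 1 short of (n + 1)!; hence their coefficient 1/(n+1).
    divide : ∀ y → q P.* ((suc n !) Pₚ.× y) P.≈ (n !) Pₚ.× y
    divide y = begin
      q P.* ((suc n !) Pₚ.× y)             ≈⟨ P.*-congˡ (Pₚ.×-assocˡ y (suc n) (n !)) ⟨
      q P.* (suc n Pₚ.× ((n !) Pₚ.× y))    ≈⟨ Pₚ.×-comm-* (suc n) q _ ⟩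
      suc n Pₚ.× (q P.* ((n !) Pₚ.× y))    ≈⟨ Pₚ.×-assoc-* (suc n) q _ ⟨
      (suc n Pₚ.× q) P.* ((n !) Pₚ.× y)    ≈⟨ P.*-congʳ (×-homo (suc n) _) ⟨
      φ (suc n Kₚ.× (K.1/ suc n)) P.* ((n !) Pₚ.× y)
        ≈⟨ P.*-congʳ (P.trans (⟦⟧-cong (Kₚ.n×1/n≈1 (suc n))) 1#-homo) ⟩
      P.1# P.* ((n !) Pₚ.× y)              ≈⟨ P.*-identityˡ _ ⟩
      (n !) Pₚ.× y                         ∎

  -- The final statement scales polynomials by scalars instead of multiplying by constants. Taking
  -- the scaling as a parameter makes the change while P is still abstract.
  recurrence-· : (_·_ : K.Carrier → P.Carrier → P.Carrier) → (∀ a y → a · y P.≈ φ a P.* y) →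
    ∀ r k n →
    s r k (suc n) P.≈
      x P.* s r k n
      P.- ((fromℤ r K.* (K.1/ suc n)) ·
          Pₚ.sum (λ (l : Fin (suc n)) → weight n (toℕ l) · s r k (toℕ l)))
      P.- ((K.1/ suc n) ·
          (s (r ℤ.+ 1ℤ) k (suc n) P.- s (r ℤ.+ 1ℤ) (k ℤ.- 1ℤ) (suc n)))
  recurrence-· _·_ ·≈φ* r k n = P.trans (recurrence r k n) (P.sym (P.+-cong
    (P.+-congˡ (P.-‿cong (P.trans (·≈φ* _ _)
      (P.*-congˡ (Pₚ.sum-cong-≋ {suc n} λ l → ·≈φ* (weight n (toℕ l)) (s r k (toℕ l)))))))
    (P.-‿cong (·≈φ* _ _))))

theorem2 : ∀ {c ℓ} (K : ℚAlgebra c ℓ) →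
    let module K = ℚAlgebra K
        open MixedType K
        open K[x]
    in
    (r k : ℤ) (n : ℕ) →
    s r k (suc n) ≈
      x * s r k n
      - (fromℤ r K.* (K.1/ suc n)) · sum (λ (l : Fin (suc n)) →
          (((suc n C toℕ l) K.× K.1#) K.* ((K.- K.1#) K.^ (suc n ∸ toℕ l)) K.* B (suc n ∸ toℕ l))
            · s r k (toℕ l))
      - (K.1/ suc n) · (s (r ℤ.+ 1ℤ) k (suc n) - s (r ℤ.+ 1ℤ) (k ℤ.- 1ℤ) (suc n))
theorem2 K = recurrence-· _·_ ·≈const*
  where
  open MixedType.K[x] K using (x; _·_)
  open PolynomialRing (ℚAlgebra.commutativeRing K)
  open Recurrence K commutativeRing const-isRingHomomorphism x
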